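{- Let $F\dashv G$ be an adjunction with $F\colon\mathcal{C}\to\mathcal{D}$ and $G\colon\mathcal{D}\to\mathcal{C}$, let $I$ be an object of $\mathcal{C}$ and $O$ an object of $\mathcal{D}$. Let $\mathcal{L}_{\mathcal{C}}$ be a $(\mathcal{C},I,GO)$-language and $\mathcal{L}_{\mathcal{D}}$ a $(\mathcal{D},FI,O)$-language such that $\mathcal{L}_{\mathcal{D}}=(\mathcal{L}_{\mathcal{C}})^*$. Then the adjunction $F\dashv G$ lifts to an adjunction $\overline{F}\dashv\overline{G}$ with $\overline{F}\colon\mathsf{Auto}(\mathcal{L}_{\mathcal{C}})\to\mathsf{Auto}(\mathcal{L}_{\mathcal{D}})$ and $\overline{G}\colon\mathsf{Auto}(\mathcal{L}_{\mathcal{D}})\to\mathsf{Auto}(\mathcal{L}_{\mathcal{C}})$. The lifted functors are defined as $F$, respectively $G$, on the state object, that is, $\mathsf{State}\circ\overline{F}=F\circ\mathsf{State}$ and $\mathsf{State}\circ\overline{G}=G\circ\mathsf{State}$.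
   Context: Fix a set $A$ (alphabet). The category $\mathcal{I}_{\mathsf{word}}$ has three objects $\mathsf{in},\mathsf{states},\mathsf{out}$ and is freely generated by arrows $\triangleright\colon\mathsf{in}\to\mathsf{states}$, $a\colon\mathsf{states}\to\mathsf{states}$ for each $a\in A$, and $\triangleleft\colon\mathsf{states}\to\mathsf{out}$. Composition is written left to right as concatenation; thus the arrows $\mathsf{states}\to\mathsf{states}$ are the words $w\in A^*$ and the arrows $\mathsf{in}\to\mathsf{out}$ are the $\triangleright w\triangleleft$, $w\in A^*$. $\mathcal{O}_{\mathsf{word}}$ is the full subcategory on $\mathsf{in},\mathsf{out}$, with inclusion $\iota$. For a category $\mathcal{K}$ and objects $X,Y$ of it, a $(\mathcal{K},X,Y)$-language is a functor $\mathcal{L}\colon\mathcal{O}_{\mathsf{word}}\to\mathcal{K}$ with $\mathcal{L}(\mathsf{in})=X$, $\mathcal{L}(\mathsf{out})=Y$. The category $\mathsf{Auto}(\mathcal{L})$ has as objects the functors $\mathcal{A}\colon\mathcal{I}_{\mathsf{word}}\to\mathcal{K}$ with $\mathcal{A}\circ\iota=\mathcal{L}$, and as arrows the natural transformations $\alpha$ with $\alpha\circ\iota=\mathrm{id}_{\mathcal{L}}$. The functor $\mathsf{State}\colon\mathsf{Auto}(\mathcal{L})\to\mathcal{K}$ is evaluation at $\mathsf{states}$: $\mathcal{A}\mapsto\mathcal{A}(\mathsf{states})$. Let $(-)^*\colon\mathcal{C}(X,GY)\to\mathcal{D}(FX,Y)$ denote the adjunction bijection. For a $(\mathcal{C},I,GO)$-language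 $\mathcal{L}$, the $(\mathcal{D},FI,O)$-language $\mathcal{L}^*$ is defined by $\mathcal{L}^*(\triangleright w\triangleleft)=(\mathcal{L}(\triangleright w\triangleleft))^*$ for all $w\in A^*$. -}

module Defs where

open import Level using (Level; _⊔_; 0ℓ)
open import Data.Empty using (⊥; ⊥-elim)
open import Function.Bundles using (Inverse)
open import Relation.Binary.Bundles using (Setoid)
open import Relation.Binary.Structures using (IsEquivalence)
open import Relation.Binary.PropositionalEquality
  using (_≡_; refl; sym; isEquivalence; cong; cong₂)
open import Relation.Binary.Construct.Closure.ReflexiveTransitive
  using (Star; ε; _◅_; _◅◅_)
open import Relation.Binary.Construct.Closure.ReflexiveTransitive.Properties
  using (◅◅-assoc)

private
  variable
    a o ℓ e o′ ℓ′ e′ o″ ℓ″ e″ o‴ ℓ‴ e‴ : Level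

-- Hom-sets are setoids; objects are compared with propositional equality.

record Category (o ℓ e : Level) : Set (Level.suc (o ⊔ ℓ ⊔ e)) where
  infix  4 _≈_ _⇒_
  infixr 9 _∘_
  field
    Obj : Set o
    _⇒_ : Obj → Obj → Set ℓ
    _≈_ : ∀ {X Y} → X ⇒ Y → X ⇒ Y → Set e
    id  : ∀ {X} → X ⇒ X
    _∘_ : ∀ {X Y Z} → Y ⇒ Z → X ⇒ Y → X ⇒ Z

    equiv     : ∀ {X Y} → IsEquivalence (_≈_ {X} {Y})
    assoc     : ∀ {W X Y Z} {f : W ⇒ X} {g : X ⇒ Y} {h : Y ⇒ Z} →
                (h ∘ g) ∘ f ≈ h ∘ (g ∘ f)
    identityˡ : ∀ {X Y} {f : X ⇒ Y} → id ∘ f ≈ f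
    identityʳ : ∀ {X Y} {f : X ⇒ Y} → f ∘ id ≈ f
    ∘-resp-≈  : ∀ {X Y Z} {f h : Y ⇒ Z} {g i : X ⇒ Y} →
                f ≈ h → g ≈ i → f ∘ g ≈ h ∘ i

  module Equiv {X Y : Obj} = IsEquivalence (equiv {X} {Y})

  hom-setoid : Obj → Obj → Setoid ℓ e
  hom-setoid X Y = record
    { Carrier = X ⇒ Y ; _≈_ = _≈_ ; isEquivalence = equiv }

  -- The identity arrow along an equality of objects: it stands for the
  -- silent identification of Hom-sets whose endpoints are equal.
  hid : ∀ {X Y} → X ≡ Y → X ⇒ Y
  hid refl = id

record Functor (C : Category o ℓ e) (D : Category o′ ℓ′ e′)
       : Set (o ⊔ ℓ ⊔ e ⊔ o′ ⊔ ℓ′ ⊔ e′) where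
  private
    module C = Category C
    module D = Category D
  field
    F₀ : C.Obj → D.Obj
    F₁ : ∀ {X Y} → X C.⇒ Y → F₀ X D.⇒ F₀ Y

    identity     : ∀ {X} → F₁ (C.id {X}) D.≈ D.id
    homomorphism : ∀ {X Y Z} {f : X C.⇒ Y} {g : Y C.⇒ Z} →
                   F₁ (g C.∘ f) D.≈ F₁ g D.∘ F₁ f
    F-resp-≈     : ∀ {X Y} {f g : X C.⇒ Y} → f C.≈ g → F₁ f D.≈ F₁ g

infixr 9 _∘F_

_∘F_ : {C : Category o ℓ e} {D : Category o′ ℓ′ e′} {E : Category o″ ℓ″ e″} →
       Functor D E → Functor C D → Functor C E
_∘F_ {E = E} G F = record
  { F₀           = λ X → G.F₀ (F.F₀ X)
  ; F₁           = λ f → G.F₁ (F.F₁ f)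
  ; identity     = E.Equiv.trans (G.F-resp-≈ F.identity) G.identity
  ; homomorphism = E.Equiv.trans (G.F-resp-≈ F.homomorphism) G.homomorphism
  ; F-resp-≈     = λ p → G.F-resp-≈ (F.F-resp-≈ p)
  }
  where
  module E = Category E
  module F = Functor F
  module G = Functor G

-- Equality of functors on the nose (not natural isomorphism): equal object
-- maps and, modulo these equalities, equal arrow maps.

infix 4 _≡F_

record _≡F_ {C : Category o ℓ e} {D : Category o′ ℓ′ e′} (F G : Functor C D)
       : Set (o ⊔ ℓ ⊔ o′ ⊔ e′) where
  private
    module C = Category C
    module D = Category D
    module F = Functor F
    module G = Functor G
  field
    eq₀ : ∀ X → F.F₀ X ≡ G.F₀ X
    eq₁ : ∀ {X Y} (f : X C.⇒ Y) →
          D.hid (eq₀ Y) D.∘ F.F₁ f D.≈ G.F₁ f D.∘ D.hid (eq₀ X)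

record NaturalTransformation {C : Category o ℓ e} {D : Category o′ ℓ′ e′}
                             (F G : Functor C D) : Set (o ⊔ ℓ ⊔ ℓ′ ⊔ e′) where
  private
    module C = Category C
    module D = Category D
    module F = Functor F
    module G = Functor G
  field
    η       : ∀ X → F.F₀ X D.⇒ G.F₀ X
    commute : ∀ {X Y} (f : X C.⇒ Y) → η Y D.∘ F.F₁ f D.≈ G.F₁ f D.∘ η X

infix 4 _⊣_

record _⊣_ {C : Category o ℓ e} {D : Category o′ ℓ′ e′}
           (F : Functor C D) (G : Functor D C)
           : Set (o ⊔ ℓ ⊔ e ⊔ o′ ⊔ ℓ′ ⊔ e′) where
  private
    module C = Category C
    module D = Category D
    module F = Functor F
    module G = Functor G
  field
    bijection : ∀ X Y → Inverse (C.hom-setoid X (G.F₀ Y)) (D.hom-setoid (F.F₀ X) Y)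

  infix 10 _*

  _* : ∀ {X Y} → X C.⇒ G.F₀ Y → F.F₀ X D.⇒ Y
  _* {X} {Y} = Inverse.to (bijection X Y)

  field
    natural : ∀ {X X′ Y Y′} (f : X′ C.⇒ X) (g : Y D.⇒ Y′) (h : X C.⇒ G.F₀ Y) →
              (G.F₁ g C.∘ (h C.∘ f)) * D.≈ g D.∘ (h * D.∘ F.F₁ f)

  *-cong : ∀ {X Y} {h k : X C.⇒ G.F₀ Y} → h C.≈ k → h * D.≈ k *
  *-cong {X} {Y} = Inverse.to-cong (bijection X Y)

-- F̄ ⊣ Ḡ lifts F ⊣ G along (P , Q): both squares of functors commute
-- on the nose and (P , Q) commutes with the two adjunction bijections,
-- i.e. it is a map of adjunctions.

record _Lifts_Along_And_
       {C : Category o ℓ e} {D : Category o′ ℓ′ e′}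
       {C̄ : Category o″ ℓ″ e″} {D̄ : Category o‴ ℓ‴ e‴}
       {F : Functor C D} {G : Functor D C} {F̄ : Functor C̄ D̄} {Ḡ : Functor D̄ C̄}
       (adj̄ : F̄ ⊣ Ḡ) (adj : F ⊣ G) (P : Functor C̄ C) (Q : Functor D̄ D)
       : Set (o ⊔ e ⊔ o′ ⊔ e′ ⊔ o″ ⊔ ℓ″ ⊔ o‴ ⊔ ℓ‴) where
  private
    module C = Category C
    module D = Category D
    module C̄ = Category C̄
    module P = Functor P
    module Q = Functor Q
    module Ḡ = Functor Ḡ
    module adj = _⊣_ adj
    module adj̄ = _⊣_ adj̄
  field
    left  : Q ∘F F̄ ≡F F ∘F P
    right : P ∘F Ḡ ≡F G ∘F Q
    bijections : ∀ {X Y} (h : X C̄.⇒ Ḡ.F₀ Y) →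
      Q.F₁ (h adj̄.*)
        D.≈ (C.hid (_≡F_.eq₀ right Y) C.∘ P.F₁ h) adj.* D.∘ D.hid (_≡F_.eq₀ left X)

FullSubcategory : (C : Category o ℓ e) {J : Set o′} →
                  (J → Category.Obj C) → Category o′ ℓ e
FullSubcategory C {J} U = record
  { Obj       = J
  ; _⇒_       = λ i j → U i C.⇒ U j
  ; _≈_       = C._≈_
  ; id        = C.id
  ; _∘_       = C._∘_
  ; equiv     = C.equiv
  ; assoc     = C.assoc
  ; identityˡ = C.identityˡ
  ; identityʳ = C.identityʳ
  ; ∘-resp-≈  = C.∘-resp-≈
  }
  where module C = Category C

inclusion : (C : Category o ℓ e) {J : Set o′} (U : J → Category.Obj C) →
            Functor (FullSubcategory C U) C
inclusion C U = record
  { F₀           = U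
  ; F₁           = λ f → f
  ; identity     = Equiv.refl
  ; homomorphism = Equiv.refl
  ; F-resp-≈     = λ p → p
  }
  where open Category C

◅◅-identityʳ : {V : Set o} {E : V → V → Set ℓ} {X Y : V} (p : Star E X Y) →
               p ◅◅ ε ≡ p
◅◅-identityʳ ε       = refl
◅◅-identityʳ (f ◅ p) = cong (f ◅_) (◅◅-identityʳ p)

FreeCategory : {V : Set o} → (V → V → Set ℓ) → Category o (o ⊔ ℓ) (o ⊔ ℓ)
FreeCategory {V = V} E = record
  { Obj       = V
  ; _⇒_       = Star E
  ; _≈_       = _≡_
  ; id        = ε
  ; _∘_       = λ q p → p ◅◅ q
  ; equiv     = isEquivalence
  ; assoc     = λ {_} {_} {_} {_} {f} {g} {h} → sym (◅◅-assoc f g h)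
  ; identityˡ = λ {_} {_} {f} → ◅◅-identityʳ f
  ; identityʳ = refl
  ; ∘-resp-≈  = λ p q → cong₂ _◅◅_ q p
  }

-- `input` and `output` are the objects written in and out.

data IObj : Set where
  input states output : IObj

data OObj : Set where
  input output : OObj

ι₀ : OObj → IObj
ι₀ input  = input
ι₀ output = output

data Generator (A : Set a) : IObj → IObj → Set a where
  ▷      : Generator A input states
  letter : A → Generator A states states
  ◁      : Generator A states output

𝓘-word : Set a → Category 0ℓ a a
𝓘-word A = FreeCategory (Generator A)

𝓞-word : Set a → Category 0ℓ a a
𝓞-word A = FullSubcategory (𝓘-word A) ι₀

ι : (A : Set a) → Functor (𝓞-word A) (𝓘-word A)
ι A = inclusion (𝓘-word A) ι₀

record Language (A : Set a) (K : Category o ℓ e) (X Y : Category.Obj K)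
       : Set (a ⊔ o ⊔ ℓ ⊔ e) where
  private module K = Category K
  field
    functor : Functor (𝓞-word A) K
  open Functor functor public
  field
    on-input  : F₀ input ≡ X
    on-output : F₀ output ≡ Y

  -- L(▷w◁), with its endpoints identified with X and Y.
  ⟦_⟧ : Star (Generator A) input output → X K.⇒ Y
  ⟦ p ⟧ = K.hid on-output K.∘ (F₁ p K.∘ K.hid (sym on-input))

module _ {A : Set a} {K : Category o ℓ e} {X Y : Category.Obj K}
         (L : Language A K X Y) where
  private
    module K = Category K
    module L = Language L

  record Automaton : Set (a ⊔ o ⊔ ℓ ⊔ e) where
    field
      functor   : Functor (𝓘-word A) K
      restricts : functor ∘F ι A ≡F L.functor
    open Functor functor public
    open _≡F_ restricts public

  -- α ∘ ι = id_L, with both A(ιX) and B(ιX) identified with L(X).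
  record AutomatonMorphism (𝒜 ℬ : Automaton) : Set (a ⊔ ℓ ⊔ e) where
    private
      module 𝒜 = Automaton 𝒜
      module ℬ = Automaton ℬ
    field
      transformation : NaturalTransformation 𝒜.functor ℬ.functor
    open NaturalTransformation transformation public
    field
      restricts : ∀ Z → K.hid (ℬ.eq₀ Z) K.∘ η (ι₀ Z) K.≈ K.id K.∘ K.hid (𝒜.eq₀ Z)

  private
    η : ∀ {𝒜 ℬ} → AutomatonMorphism 𝒜 ℬ → ∀ Z →
        Automaton.F₀ 𝒜 Z K.⇒ Automaton.F₀ ℬ Z
    η = AutomatonMorphism.η

    idA : ∀ {𝒜} → AutomatonMorphism 𝒜 𝒜
    idA {𝒜} = record
      { transformation = record
        { η       = λ _ → K.id
        ; commute = λ _ → K.Equiv.trans K.identityˡ (K.Equiv.sym K.identityʳ)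
        }
      ; restricts = λ _ → K.Equiv.trans K.identityʳ (K.Equiv.sym K.identityˡ)
      }

    _∘A_ : ∀ {𝒜 ℬ 𝒞} → AutomatonMorphism ℬ 𝒞 → AutomatonMorphism 𝒜 ℬ →
           AutomatonMorphism 𝒜 𝒞
    _∘A_ β α = record
      { transformation = record
        { η       = λ Z → β.η Z K.∘ α.η Z
        ; commute = λ f →
            K.Equiv.trans K.assoc
            (K.Equiv.trans (K.∘-resp-≈ K.Equiv.refl (α.commute f))
            (K.Equiv.trans (K.Equiv.sym K.assoc)
            (K.Equiv.trans (K.∘-resp-≈ (β.commute f) K.Equiv.refl)
            K.assoc)))
        }
      ; restricts = λ Z →
          K.Equiv.trans (K.Equiv.sym K.assoc)
          (K.Equiv.trans (K.∘-resp-≈ (K.Equiv.trans (β.restricts Z) K.identityˡ) K.Equiv.refl)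
          (α.restricts Z))
      }
      where
      module α = AutomatonMorphism α
      module β = AutomatonMorphism β

  Auto : Category (a ⊔ o ⊔ ℓ ⊔ e) (a ⊔ ℓ ⊔ e) e
  Auto = record
    { Obj       = Automaton
    ; _⇒_       = AutomatonMorphism
    ; _≈_       = λ α β → ∀ Z → η α Z K.≈ η β Z
    ; id        = idA
    ; _∘_       = _∘A_
    ; equiv     = record
      { refl  = λ _ → K.Equiv.refl
      ; sym   = λ p Z → K.Equiv.sym (p Z)
      ; trans = λ p q Z → K.Equiv.trans (p Z) (q Z)
      }
    ; assoc     = λ _ → K.assoc
    ; identityˡ = λ _ → K.identityˡ
    ; identityʳ = λ _ → K.identityʳ
    ; ∘-resp-≈  = λ p q Z → K.∘-resp-≈ (p Z) (q Z)
    }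

  State : Functor Auto K
  State = record
    { F₀           = λ 𝒜 → Automaton.F₀ 𝒜 states
    ; F₁           = λ α → AutomatonMorphism.η α states
    ; identity     = K.Equiv.refl
    ; homomorphism = K.Equiv.refl
    ; F-resp-≈     = λ p → p states
    }

module _ {A : Set a} where

  private
    no-return : Star (Generator A) states input → ⊥
    no-return (letter _ ◅ p) = no-return p
    no-return (◁ ◅ (() ◅ _))

    no-arrow : Star (Generator A) output input → ⊥
    no-arrow (() ◅ _)

    input-loop : (p : Star (Generator A) input input) → p ≡ ε
    input-loop ε       = refl
    input-loop (▷ ◅ p) = ⊥-elim (no-return p)

    output-loop : (p : Star (Generator A) output output) → p ≡ ε
    output-loop ε = refl

  -- The arrows of 𝓞-word are the identities, sent to identities, and the
  -- arrows input ⇒ output, i.e. the ▷w◁, to which (-)* is applied.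
  dual : {C : Category o ℓ e} {D : Category o′ ℓ′ e′}
         {F : Functor C D} {G : Functor D C} (adj : F ⊣ G)
         {I : Category.Obj C} {O : Category.Obj D} →
         Language A C I (Functor.F₀ G O) → Language A D (Functor.F₀ F I) O
  dual {C = C} {D = D} {F = F} adj {I} {O} L = record
    { functor = record
      { F₀           = obj
      ; F₁           = λ {X} {Y} → arr X Y
      ; identity     = λ {X} → arr-id X
      ; homomorphism = λ {X} {Y} {Z} {f} {g} → arr-∘ X Y Z f g
      ; F-resp-≈     = λ { refl → D.Equiv.refl }
      }
    ; on-input  = refl
    ; on-output = refl
    }
    where
    module D = Category D
    module O = Category (𝓞-word A)
    module F = Functor F
    module L = Language L
    open _⊣_ adj using (_*)

    obj : OObj → D.Obj
    obj input  = F.F₀ I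
    obj output = O

    arr : ∀ X Y → X O.⇒ Y → obj X D.⇒ obj Y
    arr input  input  _ = D.id
    arr input  output p = L.⟦ p ⟧ *
    arr output input  p = ⊥-elim (no-arrow p)
    arr output output _ = D.id

    arr-id : ∀ X → arr X X O.id D.≈ D.id
    arr-id input  = D.Equiv.refl
    arr-id output = D.Equiv.refl

    arr-∘ : ∀ X Y Z (f : X O.⇒ Y) (g : Y O.⇒ Z) →
            arr X Z (g O.∘ f) D.≈ arr Y Z g D.∘ arr X Y f
    arr-∘ input  input  input  _ _ = D.Equiv.sym D.identityˡ
    arr-∘ input  input  output f g rewrite input-loop f = D.Equiv.sym D.identityʳ
    arr-∘ input  output input  _ g = ⊥-elim (no-arrow g)
    arr-∘ input  output output f g rewrite output-loop g | ◅◅-identityʳ f = D.Equiv.sym D.identityˡ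
    arr-∘ output input  _      f _ = ⊥-elim (no-arrow f)
    arr-∘ output output input  _ g = ⊥-elim (no-arrow g)
    arr-∘ output output output _ _ = D.Equiv.sym D.identityˡ

{-# OPTIONS --safe #-}

-- An automaton over L amounts to a state object S with maps L(in) → S, a : S → S
-- and, for every word w◁ read from states, a map S → L(out), subject to
-- compatibility conditions.  F acts on S directly and on the maps S → L(out) by
-- transposition; G acts on S directly and on L(in) → S by inverse transposition.
-- Both constructions yield automata because the languages are transposes of each
-- other.  Since a morphism of automata is determined by its component at states,
-- the bijection of the lifted adjunction is that of F ⊣ G on this component, and
-- naturality of transposition shows that it preserves morphisms.

module Submission where

open import Level using (Level; _⊔_)
open import Data.Empty using (⊥; ⊥-elim)
open import Data.Product using (Σ-syntax; _,_)
open import Function.Bundles using (Inverse)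
open import Relation.Binary.PropositionalEquality using (_≡_; refl; sym)
open import Relation.Binary.Construct.Closure.ReflexiveTransitive
  using (Star; ε; _◅_; _◅◅_)
import Relation.Binary.Reasoning.Setoid as SetoidReasoning
open import Defs

private
  variable
    a o ℓ e o′ ℓ′ e′ : Level

-- Cancellation rules in a category, and the arrows `hid` as isomorphisms.

module CategoryProperties (K : Category o ℓ e) where
  open Category K

  module HomReasoning {X Y : Obj} = SetoidReasoning (hom-setoid X Y)

  ∘-resp-≈ˡ : ∀ {X Y Z} {f h : Y ⇒ Z} {g : X ⇒ Y} → f ≈ h → f ∘ g ≈ h ∘ g
  ∘-resp-≈ˡ p = ∘-resp-≈ p Equiv.refl

  ∘-resp-≈ʳ : ∀ {X Y Z} {f : Y ⇒ Z} {g i : X ⇒ Y} → g ≈ i → f ∘ g ≈ f ∘ i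
  ∘-resp-≈ʳ p = ∘-resp-≈ Equiv.refl p

  pullˡ : ∀ {W X Y Z} {f : Y ⇒ Z} {g : X ⇒ Y} {h : X ⇒ Z} {k : W ⇒ X} →
          f ∘ g ≈ h → f ∘ (g ∘ k) ≈ h ∘ k
  pullˡ p = Equiv.trans (Equiv.sym assoc) (∘-resp-≈ˡ p)

  pullʳ : ∀ {W X Y Z} {f : Y ⇒ Z} {g : X ⇒ Y} {k : W ⇒ X} {h : W ⇒ Y} →
          g ∘ k ≈ h → (f ∘ g) ∘ k ≈ f ∘ h
  pullʳ p = Equiv.trans assoc (∘-resp-≈ʳ p)

  cancelˡ : ∀ {X Y Z} {f : Y ⇒ Z} {g : Z ⇒ Y} {k : X ⇒ Z} →
            f ∘ g ≈ id → f ∘ (g ∘ k) ≈ k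
  cancelˡ p = Equiv.trans (pullˡ p) identityˡ

  cancelʳ : ∀ {X Y Z} {f : Y ⇒ Z} {g : Z ⇒ Y} {k : Y ⇒ X} →
            g ∘ f ≈ id → (k ∘ g) ∘ f ≈ k
  cancelʳ p = Equiv.trans (pullʳ p) identityʳ

  hid-invˡ : ∀ {X Y} (p : X ≡ Y) → hid (sym p) ∘ hid p ≈ id
  hid-invˡ refl = identityˡ

  hid-invʳ : ∀ {X Y} (p : X ≡ Y) → hid p ∘ hid (sym p) ≈ id
  hid-invʳ refl = identityˡ

-- Calculus of transposition along an adjunction, in both directions.

module AdjunctionProperties
  {C : Category o ℓ e} {D : Category o′ ℓ′ e′}
  {F : Functor C D} {G : Functor D C} (adj : F ⊣ G) where
  private
    module C = Category C
    module D = Category D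
    module CP = CategoryProperties C
    module DP = CategoryProperties D
    module F = Functor F
    module G = Functor G
  open _⊣_ adj

  infix 10 _♭

  _♭ : ∀ {X Y} → F.F₀ X D.⇒ Y → X C.⇒ G.F₀ Y
  _♭ {X} {Y} = Inverse.from (bijection X Y)

  ♭-cong : ∀ {X Y} {h k : F.F₀ X D.⇒ Y} → h D.≈ k → h ♭ C.≈ k ♭
  ♭-cong {X} {Y} = Inverse.from-cong (bijection X Y)

  *-♭ : ∀ {X Y} (h : F.F₀ X D.⇒ Y) → (h ♭) * D.≈ h
  *-♭ {X} {Y} = Inverse.strictlyInverseˡ (bijection X Y)

  ♭-* : ∀ {X Y} (h : X C.⇒ G.F₀ Y) → (h *) ♭ C.≈ h
  ♭-* {X} {Y} = Inverse.strictlyInverseʳ (bijection X Y)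

  -- Naturality with an identity in the codomain variable; `*-G∘` takes the identity in the domain
  -- variable instead.
  *-∘F : ∀ {X X′ Y} (h : X C.⇒ G.F₀ Y) (f : X′ C.⇒ X) →
         (h C.∘ f) * D.≈ h * D.∘ F.F₁ f
  *-∘F h f = begin
    (h C.∘ f) *                          ≈⟨ *-cong (C.Equiv.trans (CP.∘-resp-≈ˡ G.identity) C.identityˡ) ⟨
    (G.F₁ D.id C.∘ (h C.∘ f)) *          ≈⟨ natural f D.id h ⟩
    D.id D.∘ (h * D.∘ F.F₁ f)            ≈⟨ D.identityˡ ⟩
    h * D.∘ F.F₁ f                       ∎
    where open DP.HomReasoning

  *-G∘ : ∀ {X Y Y′} (g : Y D.⇒ Y′) (h : X C.⇒ G.F₀ Y) →
         (G.F₁ g C.∘ h) * D.≈ g D.∘ h *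
  *-G∘ g h = begin
    (G.F₁ g C.∘ h) *                     ≈⟨ *-cong (CP.∘-resp-≈ʳ C.identityʳ) ⟨
    (G.F₁ g C.∘ (h C.∘ C.id)) *          ≈⟨ natural C.id g h ⟩
    g D.∘ (h * D.∘ F.F₁ C.id)            ≈⟨ DP.∘-resp-≈ʳ (DP.∘-resp-≈ʳ F.identity) ⟩
    g D.∘ (h * D.∘ D.id)                 ≈⟨ DP.∘-resp-≈ʳ D.identityʳ ⟩
    g D.∘ h *                            ∎
    where open DP.HomReasoning

  -- Moves an equation across the bijection, so that both naturality laws of `_♭` follow from those
  -- of `_*`.
  *-adjoint : ∀ {X Y} {h : X C.⇒ G.F₀ Y} {k : F.F₀ X D.⇒ Y} → h * D.≈ k → h C.≈ k ♭
  *-adjoint p = C.Equiv.trans (C.Equiv.sym (♭-* _)) (♭-cong p)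

  ♭-∘F : ∀ {X X′ Y} (h : F.F₀ X D.⇒ Y) (f : X′ C.⇒ X) →
         h ♭ C.∘ f C.≈ (h D.∘ F.F₁ f) ♭
  ♭-∘F h f = *-adjoint (D.Equiv.trans (*-∘F (h ♭) f) (DP.∘-resp-≈ˡ (*-♭ h)))

  G∘-♭ : ∀ {X Y Y′} (g : Y D.⇒ Y′) (h : F.F₀ X D.⇒ Y) →
         G.F₁ g C.∘ h ♭ C.≈ (g D.∘ h) ♭
  G∘-♭ g h = *-adjoint (D.Equiv.trans (*-G∘ g (h ♭)) (DP.∘-resp-≈ʳ (*-♭ h)))

-- Functors and natural transformations out of a free category.

module _ {V : Set o′} {E : V → V → Set ℓ′} (K : Category o ℓ e) where
  private module K = Category K

  freeExtension : (obj : V → K.Obj) → (∀ {X Y} → E X Y → obj X K.⇒ obj Y) →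
                  Functor (FreeCategory E) K
  freeExtension obj arr = record
    { F₀           = obj
    ; F₁           = ext
    ; identity     = K.Equiv.refl
    ; homomorphism = λ {_} {_} {_} {f} {g} → ext-◅◅ f g
    ; F-resp-≈     = λ { refl → K.Equiv.refl }
    }
    where
    open CategoryProperties K

    ext : ∀ {X Y} → Star E X Y → obj X K.⇒ obj Y
    ext ε       = K.id
    ext (f ◅ p) = ext p K.∘ arr f

    ext-◅◅ : ∀ {X Y Z} (p : Star E X Y) (q : Star E Y Z) →
             ext (p ◅◅ q) K.≈ ext q K.∘ ext p
    ext-◅◅ ε       q = K.Equiv.sym K.identityʳ
    ext-◅◅ (f ◅ p) q = K.Equiv.trans (∘-resp-≈ˡ (ext-◅◅ p q)) K.assoc

  -- Naturality squares paste along composition, and every arrow of the free category is a path of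
  -- generators.
  freeTransformation :
    (P Q : Functor (FreeCategory E) K) →
    (η : ∀ X → Functor.F₀ P X K.⇒ Functor.F₀ Q X) →
    (∀ {X Y} (f : E X Y) →
       η Y K.∘ Functor.F₁ P (f ◅ ε) K.≈ Functor.F₁ Q (f ◅ ε) K.∘ η X) →
    NaturalTransformation P Q
  freeTransformation P Q η comm = record { η = η ; commute = commute }
    where
    open CategoryProperties K
    open HomReasoning
    module P = Functor P
    module Q = Functor Q

    commute : ∀ {X Y} (p : Star E X Y) → η Y K.∘ P.F₁ p K.≈ Q.F₁ p K.∘ η X
    commute {X} ε = begin
      η X K.∘ P.F₁ ε   ≈⟨ ∘-resp-≈ʳ P.identity ⟩
      η X K.∘ K.id     ≈⟨ K.identityʳ ⟩
      η X              ≈⟨ K.identityˡ ⟨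
      K.id K.∘ η X     ≈⟨ ∘-resp-≈ˡ Q.identity ⟨
      Q.F₁ ε K.∘ η X   ∎
    commute {X} {Y} (_◅_ {j = Z} f p) = begin
      -- Since `(f ◅ ε) ◅◅ p` reduces to `f ◅ p`, functoriality splits off the first generator.
      η Y K.∘ P.F₁ (f ◅ p)                   ≈⟨ ∘-resp-≈ʳ P.homomorphism ⟩
      η Y K.∘ (P.F₁ p K.∘ P.F₁ (f ◅ ε))      ≈⟨ pullˡ (commute p) ⟩
      (Q.F₁ p K.∘ η Z) K.∘ P.F₁ (f ◅ ε)      ≈⟨ pullʳ (comm f) ⟩
      Q.F₁ p K.∘ (Q.F₁ (f ◅ ε) K.∘ η X)      ≈⟨ pullˡ (K.Equiv.sym Q.homomorphism) ⟩
      Q.F₁ (f ◅ p) K.∘ η X                   ∎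

-- Automata described by their state data, and their morphisms by state maps.

no-return : {A : Set a} → Star (Generator A) states input → ⊥
no-return (letter _ ◅ p) = no-return p
no-return (◁ ◅ (() ◅ _))

module _ {A : Set a} {K : Category o ℓ e} {X Y : Category.Obj K}
         (L : Language A K X Y) where
  private
    module K = Category K
    module L = Language L
  open CategoryProperties K
  open HomReasoning

  -- The data of an automaton, with input and output literally those of L and
  -- `out w` the map from states to output induced by the word w◁.
  record StateData : Set (a ⊔ o ⊔ ℓ ⊔ e) where
    field
      S        : K.Obj
      init     : L.F₀ input K.⇒ S
      step     : A → S K.⇒ S
      out      : Star (Generator A) states output → S K.⇒ L.F₀ output
      out-step : ∀ x w → out (letter x ◅ w) K.≈ out w K.∘ step x
      out-init : ∀ w → out w K.∘ init K.≈ L.F₁ (▷ ◅ w)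

  -- An automaton agrees with `L` at the endpoints only up to `eq₀`; composing with `hid` makes
  -- `init` start and `out` end at the objects of `L` itself.
  stateData : Automaton L → StateData
  stateData 𝒜 = record
    { S        = 𝒜.F₀ states
    ; init     = 𝒜.F₁ (▷ ◅ ε) K.∘ K.hid (sym (𝒜.eq₀ input))
    ; step     = λ x → 𝒜.F₁ (letter x ◅ ε)
    ; out      = λ w → K.hid (𝒜.eq₀ output) K.∘ 𝒜.F₁ w
    ; out-step = λ x w → K.Equiv.trans (∘-resp-≈ʳ 𝒜.homomorphism) (K.Equiv.sym K.assoc)
    ; out-init = λ w → begin
        (K.hid (𝒜.eq₀ output) K.∘ 𝒜.F₁ w) K.∘ (𝒜.F₁ (▷ ◅ ε) K.∘ K.hid (sym (𝒜.eq₀ input)))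
          ≈⟨ pullʳ (pullˡ (K.Equiv.sym 𝒜.homomorphism)) ⟩
        K.hid (𝒜.eq₀ output) K.∘ (𝒜.F₁ (▷ ◅ w) K.∘ K.hid (sym (𝒜.eq₀ input)))
          ≈⟨ pullˡ (𝒜.eq₁ (▷ ◅ w)) ⟩
        (L.F₁ (▷ ◅ w) K.∘ K.hid (𝒜.eq₀ input)) K.∘ K.hid (sym (𝒜.eq₀ input))
          ≈⟨ cancelʳ (hid-invʳ (𝒜.eq₀ input)) ⟩
        L.F₁ (▷ ◅ w) ∎
    }
    where module 𝒜 = Automaton 𝒜

  automaton : StateData → Automaton L
  automaton P = record
    { functor   = functor
    ; restricts = record { eq₀ = eq₀ ; eq₁ = λ {X} {Y} → eq₁ X Y }
    }
    where
    open StateData P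

    obj : IObj → K.Obj
    obj input  = L.F₀ input
    obj states = S
    obj output = L.F₀ output

    arr : ∀ {X Y} → Generator A X Y → obj X K.⇒ obj Y
    arr ▷          = init
    arr (letter x) = step x
    arr ◁          = out (◁ ◅ ε)

    functor : Functor (𝓘-word A) K
    functor = freeExtension K obj arr

    open Functor functor using (F₁)

    -- The functor is built from `out (◁ ◅ ε)` alone; `out-step` recovers the other values by
    -- peeling letters off the word.
    F₁≈out : ∀ w → F₁ w K.≈ out w
    F₁≈out (letter x ◅ w) =
      K.Equiv.trans (∘-resp-≈ˡ (F₁≈out w)) (K.Equiv.sym (out-step x w))
    F₁≈out (◁ ◅ ε)        = K.identityˡ
    F₁≈out (◁ ◅ (() ◅ _))

    eq₀ : ∀ X → obj (ι₀ X) ≡ L.F₀ X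
    eq₀ input  = refl
    eq₀ output = refl

    -- No generator ends in `input` and none starts in `output`, so the only arrows are identities
    -- and the paths `▷ ◅ w`. The latter carry the content, supplied by `out-init`.
    eq₁ : ∀ X Y (p : Star (Generator A) (ι₀ X) (ι₀ Y)) →
          K.hid (eq₀ Y) K.∘ F₁ p K.≈ L.F₁ p K.∘ K.hid (eq₀ X)
    eq₁ input  input  ε        = ∘-resp-≈ˡ (K.Equiv.sym L.identity)
    eq₁ input  input  (▷ ◅ p)  = ⊥-elim (no-return p)
    eq₁ input  output (▷ ◅ w)  = begin
      K.id K.∘ (F₁ w K.∘ init)  ≈⟨ K.identityˡ ⟩
      F₁ w K.∘ init             ≈⟨ ∘-resp-≈ˡ (F₁≈out w) ⟩
      out w K.∘ init            ≈⟨ out-init w ⟩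
      L.F₁ (▷ ◅ w)              ≈⟨ K.identityʳ ⟨
      L.F₁ (▷ ◅ w) K.∘ K.id     ∎
    eq₁ output input  (() ◅ _)
    eq₁ output output ε        = ∘-resp-≈ˡ (K.Equiv.sym L.identity)
    eq₁ output output (() ◅ _)

  -- Naturality of `g` with identities at both endpoints. The field `out` ranges over all words
  -- rather than `◁` alone, so that the transposition arguments need no induction on words.
  record IsStateMap (P Q : StateData) (g : StateData.S P K.⇒ StateData.S Q)
         : Set (a ⊔ e) where
    private
      module P = StateData P
      module Q = StateData Q
    field
      init : g K.∘ P.init K.≈ Q.init
      step : ∀ x → g K.∘ P.step x K.≈ Q.step x K.∘ g
      out  : ∀ w → Q.out w K.∘ g K.≈ P.out w

  isStateMap-∘ : ∀ {P Q R g h} → IsStateMap Q R h → IsStateMap P Q g →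
                 IsStateMap P R (h K.∘ g)
  isStateMap-∘ h g = record
    { init = K.Equiv.trans (pullʳ g.init) h.init
    ; step = λ x → K.Equiv.trans (pullʳ (g.step x))
                   (K.Equiv.trans (pullˡ (h.step x)) K.assoc)
    ; out  = λ w → K.Equiv.trans (pullˡ (h.out w)) (g.out w)
    }
    where
    module h = IsStateMap h
    module g = IsStateMap g

  -- Serves to erase the identities that `fromAutomaton` and `toAutomaton` leave in a composite.
  isStateMap-resp-≈ : ∀ {P Q g h} → g K.≈ h → IsStateMap P Q g → IsStateMap P Q h
  isStateMap-resp-≈ g≈h g = record
    { init = K.Equiv.trans (∘-resp-≈ˡ (K.Equiv.sym g≈h)) g.init
    ; step = λ x → K.Equiv.trans (∘-resp-≈ˡ (K.Equiv.sym g≈h))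
                   (K.Equiv.trans (g.step x) (∘-resp-≈ʳ g≈h))
    ; out  = λ w → K.Equiv.trans (∘-resp-≈ʳ (K.Equiv.sym g≈h)) (g.out w)
    }
    where module g = IsStateMap g

  -- Both sides satisfy `out-step` with equal steps, so induction on the word reduces the claim to
  -- `◁`, where only identities differ.
  automaton-out : ∀ P w → StateData.out (stateData (automaton P)) w K.≈ StateData.out P w
  automaton-out P (letter x ◅ w) = begin
    Q.out (letter x ◅ w)          ≈⟨ Q.out-step x w ⟩
    Q.out w K.∘ Q.step x          ≈⟨ K.∘-resp-≈ (automaton-out P w) K.identityˡ ⟩
    P.out w K.∘ P.step x          ≈⟨ P.out-step x w ⟨
    P.out (letter x ◅ w)          ∎
    where
    module P = StateData P
    module Q = StateData (stateData (automaton P))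
  automaton-out P (◁ ◅ ε)        = K.Equiv.trans K.identityˡ K.identityˡ
  automaton-out P (◁ ◅ (() ◅ _))

  -- The round trip keeps the object `S` but changes the maps by identity factors, so it is not the
  -- identity on the nose. This state map and `toAutomaton` mediate between the two.
  fromAutomaton : ∀ P → IsStateMap (stateData (automaton P)) P K.id
  fromAutomaton P = record
    { init = K.Equiv.trans K.identityˡ (K.Equiv.trans K.identityʳ K.identityˡ)
    ; step = λ _ → K.Equiv.trans K.identityˡ
                   (K.Equiv.trans K.identityˡ (K.Equiv.sym K.identityʳ))
    ; out  = λ w → K.Equiv.trans K.identityʳ (K.Equiv.sym (automaton-out P w))
    }

  toAutomaton : ∀ P → IsStateMap P (stateData (automaton P)) K.id
  toAutomaton P = record
    { init = K.Equiv.trans K.identityˡ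
             (K.Equiv.sym (K.Equiv.trans K.identityʳ K.identityˡ))
    ; step = λ _ → K.Equiv.trans K.identityˡ
                   (K.Equiv.sym (K.Equiv.trans K.identityʳ K.identityˡ))
    ; out  = λ w → K.Equiv.trans K.identityʳ (automaton-out P w)
    }

  isStateMap : ∀ {𝒜 ℬ} (α : AutomatonMorphism L 𝒜 ℬ) →
               IsStateMap (stateData 𝒜) (stateData ℬ) (AutomatonMorphism.η α states)
  isStateMap {𝒜} {ℬ} α = record
    { init = begin
        η states K.∘ (𝒜.F₁ (▷ ◅ ε) K.∘ K.hid (sym 𝒜.in≡))       ≈⟨ pullˡ (commute (▷ ◅ ε)) ⟩
        (ℬ.F₁ (▷ ◅ ε) K.∘ η input) K.∘ K.hid (sym 𝒜.in≡)         ≈⟨ pullʳ η-input ⟩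
        ℬ.F₁ (▷ ◅ ε) K.∘ K.hid (sym ℬ.in≡)                       ∎
    ; step = λ x → commute (letter x ◅ ε)
    ; out  = λ w → begin
        (K.hid ℬ.out≡ K.∘ ℬ.F₁ w) K.∘ η states   ≈⟨ pullʳ (K.Equiv.sym (commute w)) ⟩
        K.hid ℬ.out≡ K.∘ (η output K.∘ 𝒜.F₁ w)   ≈⟨ pullˡ (restricts output) ⟩
        (K.id K.∘ K.hid 𝒜.out≡) K.∘ 𝒜.F₁ w       ≈⟨ ∘-resp-≈ˡ K.identityˡ ⟩
        K.hid 𝒜.out≡ K.∘ 𝒜.F₁ w                  ∎
    }
    where
    open AutomatonMorphism α
    module 𝒜 where
      open Automaton 𝒜 public
      in≡  = eq₀ input
      out≡ = eq₀ output
    module ℬ where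
      open Automaton ℬ public
      in≡  = eq₀ input
      out≡ = eq₀ output

    -- Solves `restricts input` for the component at `input` by inverting the arrows `hid`.
    η-input : η input K.∘ K.hid (sym 𝒜.in≡) K.≈ K.hid (sym ℬ.in≡)
    η-input = begin
      η input K.∘ K.hid (sym 𝒜.in≡)
        ≈⟨ cancelˡ (hid-invˡ ℬ.in≡) ⟨
      K.hid (sym ℬ.in≡) K.∘ (K.hid ℬ.in≡ K.∘ (η input K.∘ K.hid (sym 𝒜.in≡)))
        ≈⟨ ∘-resp-≈ʳ (pullˡ (restricts input)) ⟩
      K.hid (sym ℬ.in≡) K.∘ ((K.id K.∘ K.hid 𝒜.in≡) K.∘ K.hid (sym 𝒜.in≡))
        ≈⟨ ∘-resp-≈ʳ (cancelʳ (hid-invʳ 𝒜.in≡)) ⟩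
      K.hid (sym ℬ.in≡) K.∘ K.id
        ≈⟨ K.identityʳ ⟩
      K.hid (sym ℬ.in≡) ∎

  morphism : ∀ {𝒜 ℬ g} → IsStateMap (stateData 𝒜) (stateData ℬ) g →
             AutomatonMorphism L 𝒜 ℬ
  morphism {𝒜} {ℬ} {g} m = record
    { transformation = freeTransformation K 𝒜.functor ℬ.functor η comm
    -- The case split is what makes `η (ι₀ Z)` reduce to `endpoint Z`.
    ; restricts      = λ { input → restricts input ; output → restricts output }
    }
    where
    module 𝒜 = Automaton 𝒜
    module ℬ = Automaton ℬ
    module m = IsStateMap m

    -- The only component that `restricts` permits: identify with `L` along 𝒜, then back along ℬ.
    endpoint : ∀ Z → 𝒜.F₀ (ι₀ Z) K.⇒ ℬ.F₀ (ι₀ Z)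
    endpoint Z = K.hid (sym (ℬ.eq₀ Z)) K.∘ K.hid (𝒜.eq₀ Z)

    η : ∀ Z → 𝒜.F₀ Z K.⇒ ℬ.F₀ Z
    η input  = endpoint input
    η states = g
    η output = endpoint output

    comm : ∀ {X Y} (f : Generator A X Y) →
           η Y K.∘ 𝒜.F₁ (f ◅ ε) K.≈ ℬ.F₁ (f ◅ ε) K.∘ η X
    comm ▷ = begin
      g K.∘ 𝒜.F₁ (▷ ◅ ε)
        ≈⟨ ∘-resp-≈ʳ (cancelʳ (hid-invˡ (𝒜.eq₀ input))) ⟨
      g K.∘ ((𝒜.F₁ (▷ ◅ ε) K.∘ K.hid (sym (𝒜.eq₀ input))) K.∘ K.hid (𝒜.eq₀ input))
        ≈⟨ pullˡ m.init ⟩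
      (ℬ.F₁ (▷ ◅ ε) K.∘ K.hid (sym (ℬ.eq₀ input))) K.∘ K.hid (𝒜.eq₀ input)
        ≈⟨ K.assoc ⟩
      ℬ.F₁ (▷ ◅ ε) K.∘ endpoint input ∎
    comm (letter x) = m.step x
    comm ◁ = begin
      endpoint output K.∘ 𝒜.F₁ (◁ ◅ ε)
        ≈⟨ K.assoc ⟩
      K.hid (sym (ℬ.eq₀ output)) K.∘ (K.hid (𝒜.eq₀ output) K.∘ 𝒜.F₁ (◁ ◅ ε))
        ≈⟨ ∘-resp-≈ʳ (m.out (◁ ◅ ε)) ⟨
      K.hid (sym (ℬ.eq₀ output)) K.∘ ((K.hid (ℬ.eq₀ output) K.∘ ℬ.F₁ (◁ ◅ ε)) K.∘ g)
        ≈⟨ ∘-resp-≈ʳ K.assoc ⟩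
      K.hid (sym (ℬ.eq₀ output)) K.∘ (K.hid (ℬ.eq₀ output) K.∘ (ℬ.F₁ (◁ ◅ ε) K.∘ g))
        ≈⟨ cancelˡ (hid-invˡ (ℬ.eq₀ output)) ⟩
      ℬ.F₁ (◁ ◅ ε) K.∘ g ∎

    restricts : ∀ Z → K.hid (ℬ.eq₀ Z) K.∘ endpoint Z K.≈ K.id K.∘ K.hid (𝒜.eq₀ Z)
    restricts Z = pullˡ (hid-invʳ (ℬ.eq₀ Z))

  -- The components at input and output are forced by α ∘ ι = id.
  morphism-ext : ∀ {𝒜 ℬ} (α β : AutomatonMorphism L 𝒜 ℬ) →
                 AutomatonMorphism.η α states K.≈ AutomatonMorphism.η β states →
                 Category._≈_ (Auto L) α β
  morphism-ext {𝒜} {ℬ} α β p = λ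
    { input  → endpoint input
    ; states → p
    ; output → endpoint output
    }
    where
    module ℬ = Automaton ℬ
    module α = AutomatonMorphism α
    module β = AutomatonMorphism β

    endpoint : ∀ Z → α.η (ι₀ Z) K.≈ β.η (ι₀ Z)
    endpoint Z = begin
      α.η (ι₀ Z)
        ≈⟨ cancelˡ (hid-invˡ (ℬ.eq₀ Z)) ⟨
      K.hid (sym (ℬ.eq₀ Z)) K.∘ (K.hid (ℬ.eq₀ Z) K.∘ α.η (ι₀ Z))
        ≈⟨ ∘-resp-≈ʳ (K.Equiv.trans (α.restricts Z) (K.Equiv.sym (β.restricts Z))) ⟩
      K.hid (sym (ℬ.eq₀ Z)) K.∘ (K.hid (ℬ.eq₀ Z) K.∘ β.η (ι₀ Z))
        ≈⟨ cancelˡ (hid-invˡ (ℬ.eq₀ Z)) ⟩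
      β.η (ι₀ Z) ∎

-- Lifting the adjunction to state data and state maps.

module Lifting
  {A : Set a} {C : Category o ℓ e} {D : Category o′ ℓ′ e′}
  {F : Functor C D} {G : Functor D C} (adj : F ⊣ G)
  {I : Category.Obj C} {O : Category.Obj D}
  (L-C : Language A C I (Functor.F₀ G O))
  (L-D : Language A D (Functor.F₀ F I) O)
  (L-D≡L-C* : Language.functor L-D ≡F Language.functor (dual adj L-C)) where

  private
    module C = Category C
    module D = Category D
    module CP = CategoryProperties C
    module DP = CategoryProperties D
    module F = Functor F
    module G = Functor G
    module AC = Category (Auto L-C)
    module AD = Category (Auto L-D)
    module LC = Language L-C
    module LD = Language L-D
    module E = _≡F_ L-D≡L-C*
    open _⊣_ adj
    open AdjunctionProperties adj

    inC : LC.F₀ input C.⇒ I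
    inC = C.hid LC.on-input

    inC⁻¹ : I C.⇒ LC.F₀ input
    inC⁻¹ = C.hid (sym LC.on-input)

    outC : LC.F₀ output C.⇒ G.F₀ O
    outC = C.hid LC.on-output

    outC⁻¹ : G.F₀ O C.⇒ LC.F₀ output
    outC⁻¹ = C.hid (sym LC.on-output)

    -- The endpoints of L-D are identified with F I and O along L-D≡L-C*, which
    -- need not agree with on-input and on-output: equality proofs are not unique.
    inD : LD.F₀ input D.⇒ F.F₀ I
    inD = D.hid (E.eq₀ input)

    inD⁻¹ : F.F₀ I D.⇒ LD.F₀ input
    inD⁻¹ = D.hid (sym (E.eq₀ input))

    outD : LD.F₀ output D.⇒ O
    outD = D.hid (E.eq₀ output)

    outD⁻¹ : O D.⇒ LD.F₀ output
    outD⁻¹ = D.hid (sym (E.eq₀ output))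

  lower : StateData L-C → StateData L-D
  lower P = record
    { S        = F.F₀ S
    ; init     = F.F₁ (init C.∘ inC⁻¹) D.∘ inD
    ; step     = λ x → F.F₁ (step x)
    ; out      = λ w → outD⁻¹ D.∘ (outC C.∘ out w) *
    ; out-step = λ x w → begin
        outD⁻¹ D.∘ (outC C.∘ out (letter x ◅ w)) *
          ≈⟨ DP.∘-resp-≈ʳ (*-cong (C.Equiv.trans (CP.∘-resp-≈ʳ (out-step x w)) (C.Equiv.sym C.assoc))) ⟩
        outD⁻¹ D.∘ ((outC C.∘ out w) C.∘ step x) *
          ≈⟨ DP.∘-resp-≈ʳ (*-∘F (outC C.∘ out w) (step x)) ⟩
        outD⁻¹ D.∘ ((outC C.∘ out w) * D.∘ F.F₁ (step x))
          ≈⟨ D.assoc ⟨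
        (outD⁻¹ D.∘ (outC C.∘ out w) *) D.∘ F.F₁ (step x) ∎
    ; out-init = λ w → begin
        (outD⁻¹ D.∘ (outC C.∘ out w) *) D.∘ (F.F₁ (init C.∘ inC⁻¹) D.∘ inD)
          ≈⟨ DP.pullʳ (DP.pullˡ (D.Equiv.sym (*-∘F (outC C.∘ out w) (init C.∘ inC⁻¹)))) ⟩
        outD⁻¹ D.∘ (((outC C.∘ out w) C.∘ (init C.∘ inC⁻¹)) * D.∘ inD)
          -- With `out-init` applied, the arrow under `_*` is `LC.⟦ ▷ ◅ w ⟧` by definition.
          ≈⟨ DP.∘-resp-≈ʳ (DP.∘-resp-≈ˡ (*-cong (CP.pullʳ (CP.pullˡ (out-init w))))) ⟩
        outD⁻¹ D.∘ (LC.⟦ ▷ ◅ w ⟧ * D.∘ inD)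
          -- Here the hypothesis on the languages enters: `dual` sends `▷ ◅ w` to `LC.⟦ ▷ ◅ w ⟧ *`.
          ≈⟨ DP.∘-resp-≈ʳ (E.eq₁ {input} {output} (▷ ◅ w)) ⟨
        outD⁻¹ D.∘ (outD D.∘ LD.F₁ (▷ ◅ w))
          ≈⟨ DP.cancelˡ (DP.hid-invˡ (E.eq₀ output)) ⟩
        LD.F₁ (▷ ◅ w) ∎
    }
    where
    open StateData P
    open DP.HomReasoning

  raise : StateData L-D → StateData L-C
  raise Q = record
    { S        = G.F₀ S
    ; init     = (init D.∘ inD⁻¹) ♭ C.∘ inC
    ; step     = λ x → G.F₁ (step x)
    ; out      = λ w → outC⁻¹ C.∘ G.F₁ (outD D.∘ out w)
    ; out-step = λ x w → begin
        outC⁻¹ C.∘ G.F₁ (outD D.∘ out (letter x ◅ w))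
          ≈⟨ CP.∘-resp-≈ʳ (G.F-resp-≈ (D.Equiv.trans (DP.∘-resp-≈ʳ (out-step x w)) (D.Equiv.sym D.assoc))) ⟩
        outC⁻¹ C.∘ G.F₁ ((outD D.∘ out w) D.∘ step x)
          ≈⟨ CP.∘-resp-≈ʳ G.homomorphism ⟩
        outC⁻¹ C.∘ (G.F₁ (outD D.∘ out w) C.∘ G.F₁ (step x))
          ≈⟨ C.assoc ⟨
        (outC⁻¹ C.∘ G.F₁ (outD D.∘ out w)) C.∘ G.F₁ (step x) ∎
    ; out-init = λ w → begin
        (outC⁻¹ C.∘ G.F₁ (outD D.∘ out w)) C.∘ ((init D.∘ inD⁻¹) ♭ C.∘ inC)
          ≈⟨ CP.pullʳ (CP.pullˡ (G∘-♭ (outD D.∘ out w) (init D.∘ inD⁻¹))) ⟩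
        outC⁻¹ C.∘ (((outD D.∘ out w) D.∘ (init D.∘ inD⁻¹)) ♭ C.∘ inC)
          ≈⟨ CP.∘-resp-≈ʳ (CP.∘-resp-≈ˡ (♭-cong (DP.pullʳ (DP.pullˡ (out-init w))))) ⟩
        outC⁻¹ C.∘ ((outD D.∘ (LD.F₁ (▷ ◅ w) D.∘ inD⁻¹)) ♭ C.∘ inC)
          -- The hypothesis on the languages exhibits a transpose under `_♭`, which then cancels it.
          ≈⟨ CP.∘-resp-≈ʳ (CP.∘-resp-≈ˡ (♭-cong (DP.pullˡ (E.eq₁ {input} {output} (▷ ◅ w))))) ⟩
        outC⁻¹ C.∘ (((LC.⟦ ▷ ◅ w ⟧ * D.∘ inD) D.∘ inD⁻¹) ♭ C.∘ inC)
          ≈⟨ CP.∘-resp-≈ʳ (CP.∘-resp-≈ˡ (♭-cong (DP.cancelʳ (DP.hid-invʳ (E.eq₀ input))))) ⟩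
        outC⁻¹ C.∘ (LC.⟦ ▷ ◅ w ⟧ * ♭ C.∘ inC)
          ≈⟨ CP.∘-resp-≈ʳ (CP.∘-resp-≈ˡ (♭-* LC.⟦ ▷ ◅ w ⟧)) ⟩
        outC⁻¹ C.∘ ((outC C.∘ (LC.F₁ (▷ ◅ w) C.∘ inC⁻¹)) C.∘ inC)
          ≈⟨ CP.∘-resp-≈ʳ C.assoc ⟩
        outC⁻¹ C.∘ (outC C.∘ ((LC.F₁ (▷ ◅ w) C.∘ inC⁻¹) C.∘ inC))
          ≈⟨ CP.cancelˡ (CP.hid-invˡ LC.on-output) ⟩
        (LC.F₁ (▷ ◅ w) C.∘ inC⁻¹) C.∘ inC
          ≈⟨ CP.cancelʳ (CP.hid-invˡ LC.on-input) ⟩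
        LC.F₁ (▷ ◅ w) ∎
    }
    where
    open StateData Q
    open CP.HomReasoning

  -- Functoriality of `F` settles `init` and `step`; `out` was transposed and needs naturality in
  -- the domain. In `raise-map` it is `init` that needs naturality, in the codomain.
  lower-map : ∀ {P P′ g} → IsStateMap L-C P P′ g →
              IsStateMap L-D (lower P) (lower P′) (F.F₁ g)
  lower-map {g = g} m = record
    { init = DP.pullˡ (D.Equiv.trans (D.Equiv.sym F.homomorphism)
                                     (F.F-resp-≈ (CP.pullˡ m.init)))
    ; step = λ x → D.Equiv.trans (D.Equiv.sym F.homomorphism)
                   (D.Equiv.trans (F.F-resp-≈ (m.step x)) F.homomorphism)
    ; out  = λ w → DP.pullʳ (D.Equiv.trans (D.Equiv.sym (*-∘F _ g))
                                           (*-cong (CP.pullʳ (m.out w))))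
    }
    where module m = IsStateMap m

  raise-map : ∀ {Q Q′ g} → IsStateMap L-D Q Q′ g →
              IsStateMap L-C (raise Q) (raise Q′) (G.F₁ g)
  raise-map {g = g} m = record
    { init = CP.pullˡ (C.Equiv.trans (G∘-♭ g _) (♭-cong (DP.pullˡ m.init)))
    ; step = λ x → C.Equiv.trans (C.Equiv.sym G.homomorphism)
                   (C.Equiv.trans (G.F-resp-≈ (m.step x)) G.homomorphism)
    ; out  = λ w → CP.pullʳ (C.Equiv.trans (C.Equiv.sym G.homomorphism)
                                           (G.F-resp-≈ (DP.pullʳ (m.out w))))
    }
    where module m = IsStateMap m

  -- Naturality in the domain gives `init`, in the codomain `out`, and `step` uses both. The same
  -- division of labour holds in `untranspose`.
  transpose : ∀ {P Q h} → IsStateMap L-C P (raise Q) h → IsStateMap L-D (lower P) Q (h *)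
  transpose {P} {Q} {h} m = record
    { init = begin
        h * D.∘ (F.F₁ (P.init C.∘ inC⁻¹) D.∘ inD)
          ≈⟨ DP.pullˡ (D.Equiv.sym (*-∘F h (P.init C.∘ inC⁻¹))) ⟩
        (h C.∘ (P.init C.∘ inC⁻¹)) * D.∘ inD
          ≈⟨ DP.∘-resp-≈ˡ (*-cong (CP.pullˡ m.init)) ⟩
        (((Q.init D.∘ inD⁻¹) ♭ C.∘ inC) C.∘ inC⁻¹) * D.∘ inD
          ≈⟨ DP.∘-resp-≈ˡ (*-cong (CP.cancelʳ (CP.hid-invʳ LC.on-input))) ⟩
        (Q.init D.∘ inD⁻¹) ♭ * D.∘ inD
          ≈⟨ DP.∘-resp-≈ˡ (*-♭ (Q.init D.∘ inD⁻¹)) ⟩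
        (Q.init D.∘ inD⁻¹) D.∘ inD
          ≈⟨ DP.cancelʳ (DP.hid-invˡ (E.eq₀ input)) ⟩
        Q.init ∎
    ; step = λ x → begin
        h * D.∘ F.F₁ (P.step x)       ≈⟨ *-∘F h (P.step x) ⟨
        (h C.∘ P.step x) *            ≈⟨ *-cong (m.step x) ⟩
        (G.F₁ (Q.step x) C.∘ h) *     ≈⟨ *-G∘ (Q.step x) h ⟩
        Q.step x D.∘ h *              ∎
    ; out  = λ w → begin
        Q.out w D.∘ h *
          -- Inserting `outD` here and `outC` with its inverse below reconstructs the output map of
          -- `raise Q`, to which `m.out` applies.
          ≈⟨ DP.cancelˡ (DP.hid-invˡ (E.eq₀ output)) ⟨
        outD⁻¹ D.∘ (outD D.∘ (Q.out w D.∘ h *))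
          ≈⟨ DP.∘-resp-≈ʳ D.assoc ⟨
        outD⁻¹ D.∘ ((outD D.∘ Q.out w) D.∘ h *)
          ≈⟨ DP.∘-resp-≈ʳ (*-G∘ (outD D.∘ Q.out w) h) ⟨
        outD⁻¹ D.∘ (G.F₁ (outD D.∘ Q.out w) C.∘ h) *
          ≈⟨ DP.∘-resp-≈ʳ (*-cong (CP.cancelˡ (CP.hid-invʳ LC.on-output))) ⟨
        outD⁻¹ D.∘ (outC C.∘ (outC⁻¹ C.∘ (G.F₁ (outD D.∘ Q.out w) C.∘ h))) *
          ≈⟨ DP.∘-resp-≈ʳ (*-cong (CP.∘-resp-≈ʳ (C.Equiv.trans (C.Equiv.sym C.assoc) (m.out w)))) ⟩
        outD⁻¹ D.∘ (outC C.∘ P.out w) * ∎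
    }
    where
    open DP.HomReasoning
    module P = StateData P
    module Q = StateData Q
    module m = IsStateMap m

  untranspose : ∀ {P Q k} → IsStateMap L-D (lower P) Q k → IsStateMap L-C P (raise Q) (k ♭)
  untranspose {P} {Q} {k} m = record
    { init = begin
        k ♭ C.∘ P.init
          -- The inserted `inC⁻¹` belongs to the initial map of `lower P`.
          ≈⟨ CP.cancelʳ (CP.hid-invˡ LC.on-input) ⟨
        ((k ♭ C.∘ P.init) C.∘ inC⁻¹) C.∘ inC
          ≈⟨ CP.∘-resp-≈ˡ C.assoc ⟩
        (k ♭ C.∘ (P.init C.∘ inC⁻¹)) C.∘ inC
          ≈⟨ CP.∘-resp-≈ˡ (♭-∘F k (P.init C.∘ inC⁻¹)) ⟩
        (k D.∘ F.F₁ (P.init C.∘ inC⁻¹)) ♭ C.∘ inC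
          ≈⟨ CP.∘-resp-≈ˡ (♭-cong (DP.cancelʳ (DP.hid-invʳ (E.eq₀ input)))) ⟨
        (((k D.∘ F.F₁ (P.init C.∘ inC⁻¹)) D.∘ inD) D.∘ inD⁻¹) ♭ C.∘ inC
          ≈⟨ CP.∘-resp-≈ˡ (♭-cong (DP.∘-resp-≈ˡ (D.Equiv.trans D.assoc m.init))) ⟩
        (Q.init D.∘ inD⁻¹) ♭ C.∘ inC ∎
    ; step = λ x → begin
        k ♭ C.∘ P.step x              ≈⟨ ♭-∘F k (P.step x) ⟩
        (k D.∘ F.F₁ (P.step x)) ♭     ≈⟨ ♭-cong (m.step x) ⟩
        (Q.step x D.∘ k) ♭            ≈⟨ G∘-♭ (Q.step x) k ⟨
        G.F₁ (Q.step x) C.∘ k ♭       ∎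
    ; out  = λ w → begin
        (outC⁻¹ C.∘ G.F₁ (outD D.∘ Q.out w)) C.∘ k ♭
          ≈⟨ CP.pullʳ (G∘-♭ (outD D.∘ Q.out w) k) ⟩
        outC⁻¹ C.∘ ((outD D.∘ Q.out w) D.∘ k) ♭
          ≈⟨ CP.∘-resp-≈ʳ (♭-cong (DP.pullʳ (m.out w))) ⟩
        outC⁻¹ C.∘ (outD D.∘ (outD⁻¹ D.∘ (outC C.∘ P.out w) *)) ♭
          ≈⟨ CP.∘-resp-≈ʳ (♭-cong (DP.cancelˡ (DP.hid-invʳ (E.eq₀ output)))) ⟩
        outC⁻¹ C.∘ (outC C.∘ P.out w) * ♭
          ≈⟨ CP.∘-resp-≈ʳ (♭-* (outC C.∘ P.out w)) ⟩
        outC⁻¹ C.∘ (outC C.∘ P.out w)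
          ≈⟨ CP.cancelˡ (CP.hid-invˡ LC.on-output) ⟩
        P.out w ∎
    }
    where
    open CP.HomReasoning
    module P = StateData P
    module Q = StateData Q
    module m = IsStateMap m

  -- The lifted functors and their adjunction on automata.

  F̄₀ : Automaton L-C → Automaton L-D
  F̄₀ 𝒜 = automaton L-D (lower (stateData L-C 𝒜))

  Ḡ₀ : Automaton L-D → Automaton L-C
  Ḡ₀ ℬ = automaton L-C (raise (stateData L-D ℬ))

  -- Only the state components of F̄₁, Ḡ₁, to and from have to compute.
  abstract
    F̄₁-isStateMap : ∀ {𝒜 ℬ} (α : AutomatonMorphism L-C 𝒜 ℬ) →
      IsStateMap L-D (stateData L-D (F̄₀ 𝒜)) (stateData L-D (F̄₀ ℬ))
                 (F.F₁ (AutomatonMorphism.η α states))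
    -- `lower-map` relates the lowered data; the outer factors carry it to the automata built from
    -- them, and the resulting identities are erased.
    F̄₁-isStateMap α = isStateMap-resp-≈ L-D
      (D.Equiv.trans D.identityˡ D.identityʳ)
      (isStateMap-∘ L-D (toAutomaton L-D _)
        (isStateMap-∘ L-D (lower-map (isStateMap L-C α)) (fromAutomaton L-D _)))

    Ḡ₁-isStateMap : ∀ {𝒜 ℬ} (α : AutomatonMorphism L-D 𝒜 ℬ) →
      IsStateMap L-C (stateData L-C (Ḡ₀ 𝒜)) (stateData L-C (Ḡ₀ ℬ))
                 (G.F₁ (AutomatonMorphism.η α states))
    Ḡ₁-isStateMap α = isStateMap-resp-≈ L-C
      (C.Equiv.trans C.identityˡ C.identityʳ)
      (isStateMap-∘ L-C (toAutomaton L-C _)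
        (isStateMap-∘ L-C (raise-map (isStateMap L-D α)) (fromAutomaton L-C _)))

    to-isStateMap : ∀ {𝒜 ℬ} (α : AutomatonMorphism L-C 𝒜 (Ḡ₀ ℬ)) →
      IsStateMap L-D (stateData L-D (F̄₀ 𝒜)) (stateData L-D ℬ)
                 (AutomatonMorphism.η α states *)
    to-isStateMap {ℬ = ℬ} α = isStateMap-resp-≈ L-D
      -- Both `Ḡ₀ ℬ` and `F̄₀ 𝒜` are replaced by the data they come from, so the composite is
      -- `(id ∘ η) * ∘ id`.
      (D.Equiv.trans D.identityʳ (*-cong C.identityˡ))
      (isStateMap-∘ L-D
        (transpose {Q = stateData L-D ℬ}
          (isStateMap-∘ L-C (fromAutomaton L-C _) (isStateMap L-C α)))
        (fromAutomaton L-D _))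

    from-isStateMap : ∀ {𝒜 ℬ} (β : AutomatonMorphism L-D (F̄₀ 𝒜) ℬ) →
      IsStateMap L-C (stateData L-C 𝒜) (stateData L-C (Ḡ₀ ℬ))
                 (AutomatonMorphism.η β states ♭)
    from-isStateMap {𝒜} β = isStateMap-resp-≈ L-C
      (C.Equiv.trans C.identityˡ (♭-cong D.identityʳ))
      (isStateMap-∘ L-C (toAutomaton L-C _)
        (untranspose {P = stateData L-C 𝒜}
          (isStateMap-∘ L-D (isStateMap L-D β) (toAutomaton L-D _))))

  F̄₁ : ∀ {𝒜 ℬ} → AutomatonMorphism L-C 𝒜 ℬ → AutomatonMorphism L-D (F̄₀ 𝒜) (F̄₀ ℬ)
  F̄₁ {𝒜} {ℬ} α = morphism L-D {F̄₀ 𝒜} {F̄₀ ℬ} (F̄₁-isStateMap {𝒜} {ℬ} α)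

  Ḡ₁ : ∀ {𝒜 ℬ} → AutomatonMorphism L-D 𝒜 ℬ → AutomatonMorphism L-C (Ḡ₀ 𝒜) (Ḡ₀ ℬ)
  Ḡ₁ {𝒜} {ℬ} α = morphism L-C {Ḡ₀ 𝒜} {Ḡ₀ ℬ} (Ḡ₁-isStateMap {𝒜} {ℬ} α)

  to : ∀ {𝒜 ℬ} → AutomatonMorphism L-C 𝒜 (Ḡ₀ ℬ) → AutomatonMorphism L-D (F̄₀ 𝒜) ℬ
  to {𝒜} {ℬ} α = morphism L-D {F̄₀ 𝒜} {ℬ} (to-isStateMap {𝒜} {ℬ} α)

  from : ∀ {𝒜 ℬ} → AutomatonMorphism L-D (F̄₀ 𝒜) ℬ → AutomatonMorphism L-C 𝒜 (Ḡ₀ ℬ)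
  from {𝒜} {ℬ} β = morphism L-C {𝒜} {Ḡ₀ ℬ} (from-isStateMap {𝒜} {ℬ} β)

  F̄ : Functor (Auto L-C) (Auto L-D)
  F̄ = record
    { F₀           = F̄₀
    ; F₁           = λ {𝒜} {ℬ} → F̄₁ {𝒜} {ℬ}
    ; identity     = λ {𝒜} →
        morphism-ext L-D {F̄₀ 𝒜} {F̄₀ 𝒜}
          (F̄₁ {𝒜} {𝒜} (AC.id {𝒜})) (AD.id {F̄₀ 𝒜}) F.identity
    ; homomorphism = λ {𝒜} {ℬ} {𝒞} {α} {β} →
        morphism-ext L-D {F̄₀ 𝒜} {F̄₀ 𝒞}
          (F̄₁ {𝒜} {𝒞} (AC._∘_ {𝒜} {ℬ} {𝒞} β α))
          (AD._∘_ {F̄₀ 𝒜} {F̄₀ ℬ} {F̄₀ 𝒞} (F̄₁ {ℬ} {𝒞} β) (F̄₁ {𝒜} {ℬ} α))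
          F.homomorphism
    ; F-resp-≈     = λ {𝒜} {ℬ} {α} {β} p →
        morphism-ext L-D {F̄₀ 𝒜} {F̄₀ ℬ} (F̄₁ {𝒜} {ℬ} α) (F̄₁ {𝒜} {ℬ} β)
          (F.F-resp-≈ (p states))
    }

  Ḡ : Functor (Auto L-D) (Auto L-C)
  Ḡ = record
    { F₀           = Ḡ₀
    ; F₁           = λ {𝒜} {ℬ} → Ḡ₁ {𝒜} {ℬ}
    ; identity     = λ {𝒜} →
        morphism-ext L-C {Ḡ₀ 𝒜} {Ḡ₀ 𝒜}
          (Ḡ₁ {𝒜} {𝒜} (AD.id {𝒜})) (AC.id {Ḡ₀ 𝒜}) G.identity
    ; homomorphism = λ {𝒜} {ℬ} {𝒞} {α} {β} →
        morphism-ext L-C {Ḡ₀ 𝒜} {Ḡ₀ 𝒞}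
          (Ḡ₁ {𝒜} {𝒞} (AD._∘_ {𝒜} {ℬ} {𝒞} β α))
          (AC._∘_ {Ḡ₀ 𝒜} {Ḡ₀ ℬ} {Ḡ₀ 𝒞} (Ḡ₁ {ℬ} {𝒞} β) (Ḡ₁ {𝒜} {ℬ} α))
          G.homomorphism
    ; F-resp-≈     = λ {𝒜} {ℬ} {α} {β} p →
        morphism-ext L-C {Ḡ₀ 𝒜} {Ḡ₀ ℬ} (Ḡ₁ {𝒜} {ℬ} α) (Ḡ₁ {𝒜} {ℬ} β)
          (G.F-resp-≈ (p states))
    }

  adj̄ : F̄ ⊣ Ḡ
  adj̄ = record
    { bijection = λ 𝒜 ℬ → record
        { to        = to {𝒜} {ℬ}
        ; from      = from {𝒜} {ℬ}
        ; to-cong   = λ {α} {β} p →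
            morphism-ext L-D {F̄₀ 𝒜} {ℬ} (to {𝒜} {ℬ} α) (to {𝒜} {ℬ} β) (*-cong (p states))
        ; from-cong = λ {α} {β} p →
            morphism-ext L-C {𝒜} {Ḡ₀ ℬ} (from {𝒜} {ℬ} α) (from {𝒜} {ℬ} β) (♭-cong (p states))
        ; inverse   =
            -- Each half is stated for arguments equal up to `≈`, so a congruence precedes the
            -- inverse law at `states`.
            (λ {β} {α} p → morphism-ext L-D {F̄₀ 𝒜} {ℬ} (to {𝒜} {ℬ} α) β
              (D.Equiv.trans (*-cong (p states)) (*-♭ _)))
          , (λ {α} {β} p → morphism-ext L-C {𝒜} {Ḡ₀ ℬ} (from {𝒜} {ℬ} β) α
              (C.Equiv.trans (♭-cong (p states)) (♭-* _)))
        }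
    ; natural = λ {𝒜} {𝒜′} {ℬ} {ℬ′} α β h →
        morphism-ext L-D {F̄₀ 𝒜′} {ℬ′}
          (to {𝒜′} {ℬ′} (AC._∘_ {𝒜′} {Ḡ₀ ℬ} {Ḡ₀ ℬ′} (Ḡ₁ {ℬ} {ℬ′} β)
                                (AC._∘_ {𝒜′} {𝒜} {Ḡ₀ ℬ} h α)))
          (AD._∘_ {F̄₀ 𝒜′} {ℬ} {ℬ′} β
            (AD._∘_ {F̄₀ 𝒜′} {F̄₀ 𝒜} {ℬ} (to {𝒜} {ℬ} h) (F̄₁ {𝒜′} {𝒜} α)))
          (natural _ _ _)
    }

  -- `automaton` keeps the state object and `lower`, `raise` apply `F`, `G` to it, so the object
  -- equalities are `refl` and every `hid` is an identity.
  adj̄-lifts : adj̄ Lifts adj Along State L-C And State L-D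
  adj̄-lifts = record
    { left       = record
        { eq₀ = λ _ → refl
        ; eq₁ = λ _ → D.Equiv.trans D.identityˡ (D.Equiv.sym D.identityʳ)
        }
    ; right      = record
        { eq₀ = λ _ → refl
        ; eq₁ = λ _ → C.Equiv.trans C.identityˡ (C.Equiv.sym C.identityʳ)
        }
    ; bijections = λ _ → D.Equiv.sym (D.Equiv.trans D.identityʳ (*-cong C.identityˡ))
    }

lemma3p4 : ∀ {a o ℓ e o′ ℓ′ e′ : Level} (A : Set a)
    (C : Category o ℓ e) (D : Category o′ ℓ′ e′)
    (F : Functor C D) (G : Functor D C) (adj : F ⊣ G)
    (I : Category.Obj C) (O : Category.Obj D)
    (L-C : Language A C I (Functor.F₀ G O))
    (L-D : Language A D (Functor.F₀ F I) O) →
    Language.functor L-D ≡F Language.functor (dual adj L-C) →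
    Σ[ F̄ ∈ Functor (Auto L-C) (Auto L-D) ]
    Σ[ Ḡ ∈ Functor (Auto L-D) (Auto L-C) ]
    Σ[ adj̄ ∈ F̄ ⊣ Ḡ ]
    adj̄ Lifts adj Along State L-C And State L-D
lemma3p4 A C D F G adj I O L-C L-D L-D≡L-C* = F̄ , Ḡ , adj̄ , adj̄-lifts
  where open Lifting adj L-C L-D L-D≡L-C*
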